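{- For $n\ge 1$, the number $s_n^1(1342)$ of partial permutations of length $n$ with exactly one hole that avoid $1342$ equals $\binom{2n-2}{n-1}-\binom{2n-2}{n-5}$ (with $\binom{m}{j}=0$ for $j<0$).
   Context: A partial permutation of length $n$ with one hole is a sequence $\pi_1\cdots\pi_n$ in which each of $1,\dots,n-1$ appears exactly once and the remaining entry is a hole symbol $\diamond$. A permutation $\sigma$ of $[n]$ is an extension of $\pi$ if the standardization (order-preserving relabeling by $1,2,\dots$) of the restriction of $\sigma$ to the non-hole positions equals the restriction of $\pi$ to those positions. $\pi$ avoids a pattern $p$ if every extension of $\pi$ avoids $p$ in the classical sense. -}

module Defs where

open import Data.Nat using (ℕ; zero; suc)
open import Data.Integer using (ℤ; +_; -[1+_])
open import Data.Nat.Combinatorics using (_C_)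
open import Data.Fin using (Fin; _<_)
open import Data.Fin.Properties using () renaming (_≟_ to _≟ᶠ_)
open import Data.Maybe using (Maybe; just; nothing)
open import Data.Maybe.Properties using (≡-dec)
open import Data.Vec using (Vec; lookup; count)
open import Data.List using (List; length)
open import Data.List.Relation.Unary.Unique.Propositional using (Unique)
open import Data.List.Membership.Propositional using (_∈_)
open import Data.Product using (Σ; ∃; _×_)
open import Function.Bundles using (_⇔_)
open import Relation.Binary.PropositionalEquality using (_≡_)
open import Relation.Nullary using (¬_)

binomℤ : ℕ → ℤ → ℕ
binomℤ m (+ j)      = m C j
binomℤ m -[1+ _ ]   = 0

-- Entries of a partial permutation of length suc m: 'nothing' is the hole ◇,
-- 'just k' is the value k (values 0..m-1 stand for 1..m).
Entry : ℕ → Set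
Entry m = Maybe (Fin m)

_≟ᵉ_ : ∀ {m} (x y : Entry m) → Relation.Nullary.Dec (x ≡ y)
_≟ᵉ_ = ≡-dec _≟ᶠ_

IsPartialPerm1 : ∀ {m} → Vec (Entry m) (suc m) → Set
IsPartialPerm1 {m} π =
  (count (_≟ᵉ nothing) π ≡ 1) × (∀ (k : Fin m) → count (_≟ᵉ just k) π ≡ 1)

IsPerm : ∀ {n} → Vec (Fin n) n → Set
IsPerm {n} σ = ∀ (k : Fin n) → count (_≟ᶠ k) σ ≡ 1

-- σ is an extension of π: the restriction of σ to the non-hole positions
-- standardizes to the restriction of π, i.e. both are order-isomorphic
-- on the non-hole positions (pairwise relative order agrees).
IsExtension : ∀ {m} → Vec (Entry m) (suc m) → Vec (Fin (suc m)) (suc m) → Set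
IsExtension {m} π σ =
  IsPerm σ ×
  (∀ (i j : Fin (suc m)) (a b : Fin m) →
     lookup π i ≡ just a → lookup π j ≡ just b →
     (a < b) ⇔ (lookup σ i < lookup σ j))

Contains1342 : ∀ {n} → Vec (Fin n) n → Set
Contains1342 {n} σ =
  Σ (Fin n) λ i₁ → Σ (Fin n) λ i₂ → Σ (Fin n) λ i₃ → Σ (Fin n) λ i₄ →
    (i₁ < i₂) × (i₂ < i₃) × (i₃ < i₄) ×
    (lookup σ i₁ < lookup σ i₄) × (lookup σ i₄ < lookup σ i₂) × (lookup σ i₂ < lookup σ i₃)

Avoids1342 : ∀ {m} → Vec (Entry m) (suc m) → Set
Avoids1342 {m} π =
  ∀ (σ : Vec (Fin (suc m)) (suc m)) → IsExtension π σ → ¬ Contains1342 σ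

HasCard : ∀ {A : Set} → (A → Set) → ℕ → Set
HasCard {A} P k =
  Σ (List A) λ xs → Unique xs × (∀ x → (x ∈ xs) ⇔ P x) × (length xs ≡ k)

{-# OPTIONS --safe #-}

-- Write a partial permutation as A ◇ B. Every extension avoids 1342 iff A avoids 123, B avoids
-- 231, and there is no 132 whose letters are split by the hole as 1|32 or 13|2. Such words are
-- generated by inserting a new maximum. It may be put into A = A₁A₂ iff A₁ is decreasing and
-- A₁ > B, and into B = B₁B₂ iff B₁ < B₂ < A. Let r + 1 and k be the numbers of these sites in A
-- and in B. The generating tree has the rules
--   A empty:      (k) → (2) … (k + 1), and (r = 1, k) on putting the maximum into A;
--   A non-empty:  (r, k) → (1, k) … (r + 1, k), and k times (0, 1) on putting it into B.
-- With C the Catalan series, the series of a node is, respectively,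
--   C^(k+1) + C^(k+3) − C^(k+2) − C^3 + C^2   and   C^(r+1) + k (C^(r+2) − C^(r+1)),
-- and the coefficients of C^k are ballot numbers.
module Submission where

open import Defs
open import Data.Bool.Base using (true; false; if_then_else_)
open import Data.Empty using (⊥; ⊥-elim)
open import Data.Fin.Base as Fin using (Fin; toℕ; fromℕ; inject₁; punchIn; punchOut)
import Data.Fin.Properties as Fin
open import Data.Fin.Relation.Unary.Top using (view; ‵fromℕ; ‵inj₁)
open import Data.Integer.Base as ℤ using (ℤ; +_; _-_)
import Data.Integer.Properties as ℤ
open import Data.List.Base as List using (List; []; _∷_; _++_; map; length; concatMap)
open import Data.List.Membership.Propositional using (_∈_)
open import Data.List.Membership.Propositional.Properties
  using (∈-++⁺ˡ; ∈-++⁺ʳ; ∈-map⁺; ∈-map⁻; ∈-concatMap⁺)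
import Data.List.Properties as List
open import Data.List.Relation.Unary.All as All using (All; []; _∷_)
import Data.List.Relation.Unary.All.Properties as All
open import Data.List.Relation.Unary.AllPairs as AllPairs using (AllPairs; []; _∷_)
import Data.List.Relation.Unary.AllPairs.Properties as AllPairs
open import Data.List.Relation.Unary.Any as Any using (here; there)
open import Data.Maybe.Base as Maybe using (Maybe; just; nothing; maybe′)
open import Data.Maybe.Properties as Maybe using (just-injective)
open import Data.Nat.Base as ℕ
  using (ℕ; zero; suc; _∸_; _≤_; _<_; _>_; z≤n; s≤s; s≤s⁻¹; z<s; s<s)
open import Data.Nat.Combinatorics using (_C_; nCk+nC[k+1]≡[n+1]C[k+1]; nCk≡nC[n∸k])
open import Data.Nat.Properties
open import Data.Product.Base using (_×_; _,_; proj₁; proj₂; ∃; ∃₂)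
open import Data.Sum.Base using (_⊎_; inj₁; inj₂; [_,_]′)
open import Data.Vec.Base as Vec using (Vec; []; _∷_; lookup; count)
import Data.Vec.Properties as Vec
open import Function.Base using (_∘_; id)
open import Function.Bundles using (_⇔_; mk⇔; Equivalence)
open import Level using (0ℓ)
open import Relation.Binary.PropositionalEquality hiding ([_])
open import Relation.Nullary using (¬_; yes; no; contradiction; does)
open import Relation.Nullary.Decidable using (does-⇔; dec-true)
open import Relation.Unary using (Pred; Decidable)

open Equivalence using (to; from)

-- Labels and moves of the generating tree.

-- The label of a word carries the position of the hole (0 for front, suc h for later h), the last
-- site r to the left of the hole, and the sites to its right, counted from the hole on and
-- listed in decreasing order.
data Label : Set where
  front : List ℕ → Label
  later : (h r : ℕ) → List ℕ → Label

Moves : Set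
Moves = List (ℕ × Label)

-- A move is the position at which the maximum is inserted together with the label of the result.
frontMoves : ℕ → List ℕ → Moves
frontMoves m []       = []
frontMoves m (q ∷ qs) = (suc q , front (suc m ∷ q ∷ qs)) ∷ frontMoves m qs

leftMoves : ℕ → List ℕ → ℕ → Moves
leftMoves h qs zero    = []
leftMoves h qs (suc p) = (suc p , later (suc h) (suc p) qs) ∷ leftMoves h qs p

-- The cut `m ∸ h` stands for the final site of the child, which has length `m + 2` and its hole at
-- `suc h`.
rightMoves : ℕ → ℕ → List ℕ → Moves
rightMoves m h = map λ q → (suc (suc h ℕ.+ q) , later h 0 (m ∸ h ∷ []))

moves : ℕ → Label → Moves
moves m (front qs)     = (0 , later 0 1 qs) ∷ frontMoves m qs
moves m (later h r qs) = (0 , later (suc h) (suc r) qs) ∷ leftMoves h qs r ++ rightMoves m h qs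

-- Descendant counts and ballot numbers.

module Counting where

  open import Data.Integer.Base using (_+_; _*_; 0ℤ; 1ℤ)
  open import Data.Integer.Tactic.RingSolver using (solve-∀)
  import Data.Nat.Properties as ℕ

  -- T k n is the coefficient of xⁿ in C^k; the recursion is C^(k+1) = C^k + x C^(k+2).
  T : ℕ → ℕ → ℤ
  T zero    zero    = 1ℤ
  T zero    (suc n) = 0ℤ
  T (suc k) zero    = T k zero
  T (suc k) (suc n) = T k (suc n) + T (suc (suc k)) n

  T-zero : ∀ k → T k 0 ≡ 1ℤ
  T-zero zero    = refl
  T-zero (suc k) = T-zero k

  -- The number of descendants n levels below a node.
  total : ℕ → Label → ℤ
  total n (front qs) = T (1 ℕ.+ k) n + T (3 ℕ.+ k) n - T (2 ℕ.+ k) n - T 3 n + T 2 n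
    where k = length qs
  total n (later h r qs) = T (1 ℕ.+ r) n + + length qs * (T (2 ℕ.+ r) n - T (1 ℕ.+ r) n)

  total-zero : ∀ t → total 0 t ≡ 1ℤ
  total-zero (front qs) rewrite T-zero (length qs) = refl
  total-zero (later h r qs) rewrite T-zero r =
    trans (cong (λ z → 1ℤ + z) (ℤ.*-zeroʳ (+ length qs))) refl

  Σℤ : {A : Set} → (A → ℤ) → List A → ℤ
  Σℤ f []       = 0ℤ
  Σℤ f (x ∷ xs) = f x + Σℤ f xs

  Σℤ-++ : {A : Set} (f : A → ℤ) (xs ys : List A) → Σℤ f (xs ++ ys) ≡ Σℤ f xs + Σℤ f ys
  Σℤ-++ f []       ys = sym (ℤ.+-identityˡ _)
  Σℤ-++ f (x ∷ xs) ys = trans (cong (_+_ (f x)) (Σℤ-++ f xs ys)) (sym (ℤ.+-assoc (f x) _ _))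

  Σℤ-map : {A B : Set} (f : B → ℤ) (g : A → B) (xs : List A) → Σℤ f (map g xs) ≡ Σℤ (f ∘ g) xs
  Σℤ-map f g []       = refl
  Σℤ-map f g (x ∷ xs) = cong (_+_ (f (g x))) (Σℤ-map f g xs)

  Σℤ-cong : {A : Set} {f g : A → ℤ} → f ≗ g → ∀ xs → Σℤ f xs ≡ Σℤ g xs
  Σℤ-cong f≗g []       = refl
  Σℤ-cong f≗g (x ∷ xs) = cong₂ _+_ (f≗g x) (Σℤ-cong f≗g xs)

  Σℤ-concatMap : {A B : Set} (f : B → ℤ) (g : A → List B) (xs : List A) →
                 Σℤ f (concatMap g xs) ≡ Σℤ (Σℤ f ∘ g) xs
  Σℤ-concatMap f g []       = refl
  Σℤ-concatMap f g (x ∷ xs) =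
    trans (Σℤ-++ f (g x) (concatMap g xs)) (cong (_+_ (Σℤ f (g x))) (Σℤ-concatMap f g xs))

  Σℤ-const : {A : Set} (c : ℤ) (xs : List A) → Σℤ (λ _ → c) xs ≡ + length xs * c
  Σℤ-const c []       = sym (ℤ.*-zeroˡ c)
  Σℤ-const c (x ∷ xs) =
    trans (cong (_+_ c) (Σℤ-const c xs)) (sym (ℤ.suc-* (+ length xs) c))

  -- The sum telescopes: for p ≥ 1 the recursion turns `T (1 + p) n` into `T p (suc n)` minus
  -- `T (p ∸ 1) (suc n)`, and `T 0 (suc n)` vanishes.
  leftMoves-total : ∀ n h qs r → Σℤ (total n ∘ proj₂) (leftMoves h qs r) ≡
    T r (suc n) + + length qs * (T (suc r) (suc n) - T r (suc n) - T 1 (suc n))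
  leftMoves-total n h qs zero = eq (+ length qs) (T 2 n)
    where
    eq : ∀ k a → 0ℤ ≡ 0ℤ + k * ((0ℤ + a) - 0ℤ - (0ℤ + a))
    eq = solve-∀
  leftMoves-total n h qs (suc r) =
    trans (cong (_+_ (total n (later (suc h) (suc r) qs))) (leftMoves-total n h qs r))
          (eq (+ length qs) (T (2 ℕ.+ r) n) (T (3 ℕ.+ r) n) (T r (suc n)) (T 1 (suc n)))
    where
    eq : ∀ k a b c d →
      (a + k * (b - a)) + (c + k * ((c + a) - c - d)) ≡
      (c + a) + k * ((c + a + b) - (c + a) - d)
    eq = solve-∀

  -- The child made from a tail of length `j` has `j + 2` cuts, so its three varying terms telescope
  -- in `j`, with lower ends `T 1`, `T 3` and `T 2`; the two constant terms are collected `k` times.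
  frontMoves-total : ∀ m n qs → let k = length qs in
    Σℤ (total n ∘ proj₂) (frontMoves m qs) ≡
    T (1 ℕ.+ k) (suc n) + T (3 ℕ.+ k) (suc n) - T (2 ℕ.+ k) (suc n)
    - (T 1 (suc n) + T 3 (suc n) - T 2 (suc n)) - + k * (T 3 n - T 2 n)
  frontMoves-total m n [] = eq (T 1 (suc n)) (T 2 (suc n)) (T 3 (suc n)) (T 3 n - T 2 n)
    where
    eq : ∀ a b c d → 0ℤ ≡ a + c - b - (a + c - b) - 0ℤ * d
    eq = solve-∀
  frontMoves-total m n (q ∷ qs) =
    trans (cong (_+_ (total n (front (suc m ∷ q ∷ qs)))) (frontMoves-total m n qs))
          (eq (+ k) (T (3 ℕ.+ k) n) (T (4 ℕ.+ k) n) (T (5 ℕ.+ k) n)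
                     (T (1 ℕ.+ k) (suc n)) (T 1 (suc n) + T 3 (suc n) - T 2 (suc n)) (T 2 n) (T 3 n))
    where
    k = length qs
    eq : ∀ k x y z a s u v →
      (x + z - y - v + u) + (a + (a + x + y) - (a + x) - s - k * (v - u)) ≡
      (a + x) + (a + x + y + z) - (a + x + y) - s - (1ℤ + k) * (v - u)
    eq = solve-∀

  -- Descendants `suc n` levels below a node are those `n` levels below its children. With
  -- `total-zero` as initial value, this makes `total` a count.
  moves-total : ∀ m n t → Σℤ (total n ∘ proj₂) (moves m t) ≡ total (suc n) t
  moves-total m n (front qs) =
    trans (cong (_+_ (total n (later 0 1 qs))) (frontMoves-total m n qs))
          (eq (+ length qs) (T 2 n) (T 3 n) (T (1 ℕ.+ length qs) (suc n))
              (T (2 ℕ.+ length qs) (suc n)) (T (3 ℕ.+ length qs) (suc n)) (T 3 (suc n)) (T 2 (suc n)))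
    where
    eq : ∀ k u v a b c x y →
      (u + k * (v - u)) + (a + c - b - ((0ℤ + u) + x - y) - k * (v - u)) ≡ a + c - b - x + y
    eq = solve-∀
  moves-total m n (later h r qs) =
    trans (cong (_+_ (total n (later (suc h) (suc r) qs))) (trans (Σℤ-++ (total n ∘ proj₂) (leftMoves h qs r) (rightMoves m h qs))
          (cong₂ _+_ (leftMoves-total n h qs r)
            (trans (Σℤ-map (total n ∘ proj₂) _ qs) (Σℤ-const _ qs)))))
          (eq (+ length qs) (T 1 n) (T 2 n) (T (2 ℕ.+ r) n) (T (3 ℕ.+ r) n) (T r (suc n)))
    where
    eq : ∀ k o u a b c →
      (a + k * (b - a)) + ((c + k * ((c + a) - c - (0ℤ + u))) + k * (o + 1ℤ * (u - o))) ≡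
      (c + a) + k * ((c + a + b) - (c + a))
    eq = solve-∀

  -- chooseShift d n k is n C (k − d), zero when k < d; this makes Pascal's rule hold for all k.
  chooseShift : ℕ → ℕ → ℕ → ℕ
  chooseShift zero    n k       = n C k
  chooseShift (suc d) n zero    = 0
  chooseShift (suc d) n (suc k) = chooseShift d n k

  pascal : ∀ d n k → chooseShift d (suc n) k ≡ chooseShift (suc d) n k ℕ.+ chooseShift d n k
  pascal zero          n zero    = refl
  pascal zero          n (suc k) = sym (nCk+nC[k+1]≡[n+1]C[k+1] n k)
  pascal (suc d)       n zero    = refl
  pascal (suc d)       n (suc k) = pascal d n k

  opaque
    ⟦_⟧ : ℕ → ℕ → ℕ → ℤ
    ⟦ d ⟧ n k = + chooseShift d n k

    ⟦⟧-def : ∀ d n k → ⟦ d ⟧ n k ≡ + chooseShift d n k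
    ⟦⟧-def d n k = refl

    ⟦⟧-suc : ∀ d n k → ⟦ suc d ⟧ n (suc k) ≡ ⟦ d ⟧ n k
    ⟦⟧-suc d n k = refl

    ⟦⟧-zero : ∀ n → ⟦ 0 ⟧ n 0 - ⟦ 1 ⟧ n 0 ≡ 1ℤ
    ⟦⟧-zero n = refl

    pascalℤ : ∀ d n k → ⟦ d ⟧ (suc n) k ≡ ⟦ suc d ⟧ n k + ⟦ d ⟧ n k
    pascalℤ d n k = trans (cong +_ (pascal d n k)) (ℤ.pos-+ (chooseShift (suc d) n k) (chooseShift d n k))

    middle : ∀ n → ⟦ 0 ⟧ (suc (n ℕ.+ n)) (suc n) ≡ ⟦ 0 ⟧ (suc (n ℕ.+ n)) n
    middle n = cong +_ (trans (nCk≡nC[n∸k] (ℕ.s≤s (ℕ.m≤m+n n n)))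
                              (cong (suc (n ℕ.+ n) C_) (ℕ.m+n∸m≡n n n)))

  -- For 2k ≤ n this counts the paths of `n` unit steps, `k` of them down, that never go below their
  -- start.
  ballot : ℕ → ℕ → ℤ
  ballot n k = ⟦ 0 ⟧ n k - ⟦ 1 ⟧ n k

  ballot-suc : ∀ n k → ballot (suc n) (suc k) ≡ ballot n k + ballot n (suc k)
  ballot-suc n k
    rewrite pascalℤ 0 n (suc k) | pascalℤ 1 n (suc k)
          | ⟦⟧-suc 1 n k | ⟦⟧-suc 0 n k = eq (⟦ 0 ⟧ n (suc k)) (⟦ 0 ⟧ n k) (⟦ 1 ⟧ n k)
    where
    eq : ∀ a b c → b + a - (c + b) ≡ (b - c) + (a - b)
    eq = solve-∀

  -- The two middle binomials of an odd row agree. This is the boundary value that matches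
  -- `T 0 (suc n)`.
  ballot-middle : ∀ n → ballot (suc (n ℕ.+ n)) (suc n) ≡ 0ℤ
  ballot-middle n rewrite ⟦⟧-suc 0 (suc (n ℕ.+ n)) n | middle n = ℤ.+-inverseʳ (⟦ 0 ⟧ (suc (n ℕ.+ n)) n)

  -- Under this substitution the recursion of `T` becomes `ballot-suc`; at k = 0 the term
  -- `T 0 (suc n)` is supplied by `ballot-middle`.
  T-binomial : ∀ k n → T (suc k) n ≡ ballot (k ℕ.+ (n ℕ.+ n)) n
  T-binomial k       zero    = trans (T-zero k) (sym (⟦⟧-zero (k ℕ.+ 0)))
  T-binomial zero    (suc n) = begin
    0ℤ + T 2 n                                                 ≡⟨ ℤ.+-comm 0ℤ (T 2 n) ⟩
    T 2 n + 0ℤ                                                 ≡⟨ cong₂ _+_ (T-binomial 1 n) (sym (ballot-middle n)) ⟩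
    ballot (suc (n ℕ.+ n)) n + ballot (suc (n ℕ.+ n)) (suc n)  ≡⟨ ballot-suc (suc (n ℕ.+ n)) n ⟨
    ballot (suc (suc (n ℕ.+ n))) (suc n)                       ≡⟨ cong (λ N → ballot (suc N) (suc n)) (ℕ.+-suc n n) ⟨
    ballot (suc n ℕ.+ suc n) (suc n)                           ∎
    where open ≡-Reasoning
  T-binomial (suc k) (suc n) = begin
    T (suc k) (suc n) + T (3 ℕ.+ k) n                          ≡⟨ cong₂ _+_ (T-binomial k (suc n)) (T-binomial (2 ℕ.+ k) n) ⟩
    ballot N (suc n) + ballot (2 ℕ.+ (k ℕ.+ (n ℕ.+ n))) n      ≡⟨ cong (λ M → ballot N (suc n) + ballot M n) shift ⟩
    ballot N (suc n) + ballot N n                              ≡⟨ ℤ.+-comm (ballot N (suc n)) _ ⟩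
    ballot N n + ballot N (suc n)                              ≡⟨ ballot-suc N n ⟨
    ballot (suc N) (suc n)                                     ∎
    where
    open ≡-Reasoning
    N = k ℕ.+ (suc n ℕ.+ suc n)
    shift : 2 ℕ.+ (k ℕ.+ (n ℕ.+ n)) ≡ N
    shift = sym (trans (ℕ.+-suc k (n ℕ.+ suc n))
                       (cong suc (trans (cong (k ℕ.+_) (ℕ.+-suc n n)) (ℕ.+-suc k (n ℕ.+ n)))))

  -- With one cut, `total` is 2 `T 2` - 2 `T 3` + `T 4`. Pascal's rule brings the three ballot
  -- numbers down to row `n + n`, where all but the two outer binomials cancel.
  total-root : ∀ q n → total n (front (q ∷ [])) ≡ ⟦ 0 ⟧ (n ℕ.+ n) n - ⟦ 4 ⟧ (n ℕ.+ n) n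
  total-root q n
    rewrite T-binomial 1 n | T-binomial 2 n | T-binomial 3 n
          | pascalℤ 0 (2 ℕ.+ (n ℕ.+ n)) n | pascalℤ 1 (2 ℕ.+ (n ℕ.+ n)) n
          | pascalℤ 0 (1 ℕ.+ (n ℕ.+ n)) n | pascalℤ 1 (1 ℕ.+ (n ℕ.+ n)) n | pascalℤ 2 (1 ℕ.+ (n ℕ.+ n)) n
          | pascalℤ 0 (n ℕ.+ n) n | pascalℤ 1 (n ℕ.+ n) n | pascalℤ 2 (n ℕ.+ n) n | pascalℤ 3 (n ℕ.+ n) n =
    eq (⟦ 0 ⟧ (n ℕ.+ n) n) (⟦ 1 ⟧ (n ℕ.+ n) n) (⟦ 2 ⟧ (n ℕ.+ n) n) (⟦ 3 ⟧ (n ℕ.+ n) n) (⟦ 4 ⟧ (n ℕ.+ n) n)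
    where
    eq : ∀ a b c d e →
      (b + a - (c + b)) + (((d + c) + (c + b)) + ((c + b) + (b + a)) - (((e + d) + (d + c)) + ((d + c) + (c + b))))
      - (((c + b) + (b + a)) - ((d + c) + (c + b))) - (((c + b) + (b + a)) - ((d + c) + (c + b)))
      + (b + a - (c + b)) ≡ a - e
    eq = solve-∀

  -- The identity is first proved with the subtrahend `c` added to `l`, so that the truncated
  -- subtraction is exact.
  count-formula : ∀ l n → + l ≡ total n (front (0 ∷ [])) →
                  l ≡ (2 ℕ.* n) C n ∸ binomℤ (2 ℕ.* n) (+ n - + 4)
  count-formula l n l≡ = begin
    l                                           ≡⟨ ℕ.m+n∸n≡m l c ⟨
    (l ℕ.+ c) ∸ c                               ≡⟨ cong (_∸ c) (ℤ.+-injective sum) ⟩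
    (n ℕ.+ n) C n ∸ c                           ≡⟨ cong₂ (λ N d → N C n ∸ d) (cong (n ℕ.+_) (sym (ℕ.+-identityʳ n))) shift ⟩
    (2 ℕ.* n) C n ∸ binomℤ (2 ℕ.* n) (+ n - + 4) ∎
    where
    open ≡-Reasoning
    c = chooseShift 4 (n ℕ.+ n) n
    sum : + (l ℕ.+ c) ≡ + ((n ℕ.+ n) C n)
    sum = begin
      + (l ℕ.+ c)                                   ≡⟨ ℤ.pos-+ l c ⟩
      + l + + c                                     ≡⟨ cong₂ _+_ (trans l≡ (total-root 0 n)) (sym (⟦⟧-def 4 (n ℕ.+ n) n)) ⟩
      (⟦ 0 ⟧ (n ℕ.+ n) n - ⟦ 4 ⟧ (n ℕ.+ n) n) + ⟦ 4 ⟧ (n ℕ.+ n) n ≡⟨ eq (⟦ 0 ⟧ (n ℕ.+ n) n) (⟦ 4 ⟧ (n ℕ.+ n) n) ⟩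
      ⟦ 0 ⟧ (n ℕ.+ n) n                             ≡⟨ ⟦⟧-def 0 (n ℕ.+ n) n ⟩
      + ((n ℕ.+ n) C n)                             ∎
      where
      eq : ∀ a b → (a - b) + b ≡ a
      eq = solve-∀
    shift : chooseShift 4 (n ℕ.+ n) n ≡ binomℤ (2 ℕ.* n) (+ n - + 4)
    shift = trans (cong (λ N → chooseShift 4 N n) (cong (n ℕ.+_) (sym (ℕ.+-identityʳ n)))) (step (2 ℕ.* n) n)
      where
      step : ∀ N n → chooseShift 4 N n ≡ binomℤ N (+ n - + 4)
      -- For n < 4 the lower index is negative and both sides are 0.
      step N 0 = refl
      step N 1 = refl
      step N 2 = refl
      step N 3 = refl
      step N (suc (suc (suc (suc n)))) = refl

open Counting
open import Data.Nat.Base using (_+_; _*_)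

-- Positions under insertion.

private variable
  m n p q h i j k x : ℕ
  e e′ : Maybe ℕ
  t : Label

-- punchIn on ℕ: the new position of entry i after an insertion at p.
skip : ℕ → ℕ → ℕ
skip zero    i       = suc i
skip (suc p) zero    = zero
skip (suc p) (suc i) = suc (skip p i)

skip-mono-< : ∀ p → i < j → skip p i < skip p j
skip-mono-< zero i<j = s<s i<j
skip-mono-< {zero}  {suc j} (suc p) i<j = z<s
skip-mono-< {suc i} {suc j} (suc p) i<j = s<s (skip-mono-< p (s≤s⁻¹ i<j))

skip-mono-≤ : ∀ p → i ≤ j → skip p i ≤ skip p j
skip-mono-≤ {i} {j} p i≤j with m≤n⇒m<n∨m≡n i≤j
... | inj₁ i<j  = <⇒≤ (skip-mono-< p i<j)
... | inj₂ refl = ≤-refl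

skip-cancel-< : ∀ p → skip p i < skip p j → i < j
skip-cancel-< {i} {j} p lt = ≰⇒> λ j≤i → <⇒≱ lt (skip-mono-≤ p j≤i)

skip-below : i < p → skip p i ≡ i
skip-below {zero}  {suc p} i<p = refl
skip-below {suc i} {suc p} i<p = cong suc (skip-below (s≤s⁻¹ i<p))

skip-above : p ≤ i → skip p i ≡ suc i
skip-above {zero}          p≤i = refl
skip-above {suc p} {suc i} p≤i = cong suc (skip-above (s≤s⁻¹ p≤i))

skip-≥ : ∀ p i → i ≤ skip p i
skip-≥ zero    i       = n≤1+n i
skip-≥ (suc p) zero    = z≤n
skip-≥ (suc p) (suc i) = s≤s (skip-≥ p i)

skip-<⁺ : i < p → skip p i < p
skip-<⁺ {i} {p} i<p = subst (_< p) (sym (skip-below i<p)) i<p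

skip-<⁻ : ∀ p → skip p i < p → i < p
skip-<⁻ {i} p lt = ≤-<-trans (skip-≥ p i) lt

skip->⁺ : p ≤ i → p < skip p i
skip->⁺ {p} p≤i = subst (p <_) (sym (skip-above p≤i)) (s≤s p≤i)

skip->⁻ : ∀ p → p < skip p i → p ≤ i
skip->⁻ p lt = ≮⇒≥ λ i<p → <-asym lt (skip-<⁺ i<p)

data SkipView (p : ℕ) : ℕ → Set where
  gap     : SkipView p p
  skipped : ∀ i → SkipView p (skip p i)

skipView : ∀ p i → SkipView p i
skipView zero    zero    = gap
skipView zero    (suc i) = skipped i
skipView (suc p) zero    = skipped zero
skipView (suc p) (suc i) with skipView p i
... | gap       = gap
... | skipped i = skipped (suc i)

-- Words and the insertion of a maximum.

Word : ℕ → ℕ → Set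
Word m n = Vec (Entry m) n

-- Positions and values are plain numbers here, so that an insertion moves positions by `skip` and
-- leaves values alone, without casts between `Fin m` and `Fin (suc m)`.
data At {m} : ∀ {n} → Word m n → ℕ → Maybe ℕ → Set where
  here  : ∀ {y} {w : Word m n} → Maybe.map toℕ y ≡ e → At (y ∷ w) zero e
  there : ∀ {y} {w : Word m n} → At w i e → At (y ∷ w) (suc i) e

At-functional : {w : Word m n} → At w i e → At w i e′ → e ≡ e′
At-functional (here p)  (here q)  = trans (sym p) q
At-functional (there a) (there b) = At-functional a b

At-total : (w : Word m n) → i < n → ∃ (At w i)
At-total {i = zero}  (y ∷ w) i<n = _ , here refl
At-total {i = suc i} (y ∷ w) i<n with At-total w (s≤s⁻¹ i<n)
... | e , a = e , there a

At⇒< : {w : Word m n} → At w i e → i < n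
At⇒< (here _)  = z<s
At⇒< (there a) = s<s (At⇒< a)

At-value< : {w : Word m n} → At w i (just x) → x < m
At-value< (here {y = just a} eq) = subst (_< _) (just-injective eq) (Fin.toℕ<n a)
At-value< (there a) = At-value< a

raise : Entry m → Entry (suc m)
raise = Maybe.map inject₁

toℕ-raise : (y : Entry m) → Maybe.map toℕ (raise y) ≡ Maybe.map toℕ y
toℕ-raise nothing  = refl
toℕ-raise (just a) = cong just (Fin.toℕ-inject₁ a)

addMax : ℕ → Word m n → Word (suc m) (suc n)
addMax zero    w       = just (fromℕ _) ∷ Vec.map raise w
-- A site beyond the end acts as the end; hence the bounds `p ≤ n` in the lemmas that locate the
-- maximum.
addMax (suc p) []      = just (fromℕ _) ∷ []
addMax (suc p) (y ∷ w) = raise y ∷ addMax p w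

At-raise⁺ : {w : Word m n} → At w i e → At (Vec.map raise w) i e
At-raise⁺ (here {y = y} eq) = here (trans (toℕ-raise y) eq)
At-raise⁺ (there a)         = there (At-raise⁺ a)

At-raise⁻ : {w : Word m n} → At (Vec.map raise w) i e → At w i e
At-raise⁻ {w = y ∷ w} (here eq) = here (trans (sym (toℕ-raise y)) eq)
At-raise⁻ {w = y ∷ w} (there a) = there (At-raise⁻ a)

At-skip⁺ : ∀ p {w : Word m n} → At w i e → At (addMax p w) (skip p i) e
At-skip⁺ zero    a                 = there (At-raise⁺ a)
At-skip⁺ (suc p) (here {y = y} eq) = here (trans (toℕ-raise y) eq)
At-skip⁺ (suc p) (there a)         = there (At-skip⁺ p a)

At-skip⁻ : {w : Word m n} → p ≤ n → At (addMax p w) (skip p i) e → At w i e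
At-skip⁻ {p = zero}                              p≤n (there a) = At-raise⁻ a
At-skip⁻ {p = suc p} {i = zero}  {w = y ∷ w} p≤n (here eq) = here (trans (sym (toℕ-raise y)) eq)
At-skip⁻ {p = suc p} {i = suc i} {w = y ∷ w} p≤n (there a) = there (At-skip⁻ (s≤s⁻¹ p≤n) a)

At-max⁺ : (w : Word m n) → p ≤ n → At (addMax p w) p (just m)
At-max⁺ {p = zero}  w       p≤n = here (cong just (Fin.toℕ-fromℕ _))
At-max⁺ {p = suc p} (y ∷ w) p≤n = there (At-max⁺ w (s≤s⁻¹ p≤n))

Lt : Word m n → ℕ → ℕ → Set
Lt w i j = ∃₂ λ x y → At w i (just x) × At w j (just y) × x < y

Lt-skip⁺ : ∀ p {w : Word m n} → Lt w i j → Lt (addMax p w) (skip p i) (skip p j)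
Lt-skip⁺ p (x , y , a , b , x<y) = x , y , At-skip⁺ p a , At-skip⁺ p b , x<y

Lt-skip⁻ : {w : Word m n} → p ≤ n → Lt (addMax p w) (skip p i) (skip p j) → Lt w i j
Lt-skip⁻ p≤n (x , y , a , b , x<y) = x , y , At-skip⁻ p≤n a , At-skip⁻ p≤n b , x<y

Lt-max⁺ : {w : Word m n} → p ≤ n → At w i (just x) → Lt (addMax p w) (skip p i) p
Lt-max⁺ {p = p} {w = w} p≤n a = _ , _ , At-skip⁺ p a , At-max⁺ w p≤n , At-value< a

Lt-max⁻ : {w : Word m n} → p ≤ n → ¬ Lt (addMax p w) p j
Lt-max⁻ {w = w} p≤n (x , y , a , b , x<y) with At-functional a (At-max⁺ w p≤n)
... | refl = <⇒≱ x<y (s≤s⁻¹ (At-value< b))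

-- Forbidden patterns and valid sites.

-- Forbidden patterns, with ∣ marking the hole: no1∣32 and no13∣2 exclude a 132 split by it.
record Good (w : Word m n) (h : ℕ) : Set where
  field
    no123   : i < j → j < k → k < h → Lt w i j → ¬ Lt w j k
    no231   : h < i → i < j → j < k → Lt w k i → ¬ Lt w i j
    no1∣32  : i < h → h < j → j < k → Lt w i k → ¬ Lt w k j
    no13∣2  : i < j → j < h → h < k → Lt w i k → ¬ Lt w k j

-- Valid w h p: a new maximum at site p of a word with hole at h completes no forbidden pattern;
-- each field is a forbidden pattern deprived of its largest letter.
record Valid {m n} (w : Word m n) (h p : ℕ) : Set where
  field
    bound   : p ≤ n
    no12∣   : p ≤ h → i < j → j < p → ¬ Lt w i j
    no1∣2ˡ  : p ≤ h → i < p → h < k → ¬ Lt w i k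
    no1∣2ʳ  : h < p → i < h → p ≤ k → ¬ Lt w i k
    no2∣1   : h < p → h < i → i < p → p ≤ k → ¬ Lt w k i

open Good
open Valid

-- The maximum can only be the largest letter of a forbidden pattern. If it is, the other two
-- letters contradict `Valid`; if it does not take part, the pattern already lies in `w`.
Good-addMax⁺ : {w : Word m n} → Good w h → Valid w h p → Good (addMax p w) (skip p h)
Good-addMax⁺ {h = h} {p = p} {w = w} g v = record { no123 = a ; no231 = b ; no1∣32 = c ; no13∣2 = d }
  where
  p≤n = bound v
  a : i < j → j < k → k < skip p h → Lt (addMax p w) i j → ¬ Lt (addMax p w) j k
  a {i} {j} {k} i<j j<k k<h l₁ l₂ with skipView p i | skipView p j | skipView p k
  ... | gap       | _         | _         = Lt-max⁻ p≤n l₁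
  ... | skipped i | gap       | _         = Lt-max⁻ p≤n l₂
  ... | skipped i | skipped j | gap       =
    no12∣ v (skip->⁻ p k<h) (skip-cancel-< p i<j) (skip-<⁻ p j<k) (Lt-skip⁻ p≤n l₁)
  ... | skipped i | skipped j | skipped k =
    no123 g (skip-cancel-< p i<j) (skip-cancel-< p j<k) (skip-cancel-< p k<h) (Lt-skip⁻ p≤n l₁) (Lt-skip⁻ p≤n l₂)
  b : skip p h < i → i < j → j < k → Lt (addMax p w) k i → ¬ Lt (addMax p w) i j
  b {i} {j} {k} h<i i<j j<k l₁ l₂ with skipView p i | skipView p j | skipView p k
  ... | gap       | _         | _         = Lt-max⁻ p≤n l₂
  ... | skipped i | _         | gap       = Lt-max⁻ p≤n l₁
  ... | skipped i | gap       | skipped k =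
    no2∣1 v (skip-<⁻ p (<-trans h<i i<j)) (skip-cancel-< p h<i) (skip-<⁻ p i<j) (skip->⁻ p j<k) (Lt-skip⁻ p≤n l₁)
  ... | skipped i | skipped j | skipped k =
    no231 g (skip-cancel-< p h<i) (skip-cancel-< p i<j) (skip-cancel-< p j<k) (Lt-skip⁻ p≤n l₁) (Lt-skip⁻ p≤n l₂)
  c : i < skip p h → skip p h < j → j < k → Lt (addMax p w) i k → ¬ Lt (addMax p w) k j
  c {i} {j} {k} i<h h<j j<k l₁ l₂ with skipView p i | skipView p j | skipView p k
  ... | gap       | _         | _         = Lt-max⁻ p≤n l₁
  ... | skipped i | _         | gap       = Lt-max⁻ p≤n l₂
  ... | skipped i | gap       | skipped k =
    no1∣2ʳ v (skip-<⁻ p h<j) (skip-cancel-< p i<h) (skip->⁻ p j<k) (Lt-skip⁻ p≤n l₁)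
  ... | skipped i | skipped j | skipped k =
    no1∣32 g (skip-cancel-< p i<h) (skip-cancel-< p h<j) (skip-cancel-< p j<k) (Lt-skip⁻ p≤n l₁) (Lt-skip⁻ p≤n l₂)
  d : i < j → j < skip p h → skip p h < k → Lt (addMax p w) i k → ¬ Lt (addMax p w) k j
  d {i} {j} {k} i<j j<h h<k l₁ l₂ with skipView p i | skipView p j | skipView p k
  ... | gap       | _         | _         = Lt-max⁻ p≤n l₁
  ... | skipped i | _         | gap       = Lt-max⁻ p≤n l₂
  ... | skipped i | gap       | skipped k =
    no1∣2ˡ v (skip->⁻ p j<h) (skip-<⁻ p i<j) (skip-cancel-< p h<k) (Lt-skip⁻ p≤n l₁)
  ... | skipped i | skipped j | skipped k =
    no13∣2 g (skip-cancel-< p i<j) (skip-cancel-< p j<h) (skip-cancel-< p h<k) (Lt-skip⁻ p≤n l₁) (Lt-skip⁻ p≤n l₂)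

-- Patterns of `w` persist under insertion. Thus good words have good parents, which lets the tree
-- reach them.
Good-addMax⁻ : ∀ p {w : Word m n} → Good (addMax p w) (skip p h) → Good w h
Good-addMax⁻ p g = record
  { no123  = λ i<j j<k k<h l₁ l₂ → no123 g (mono i<j) (mono j<k) (mono k<h) (Lt-skip⁺ p l₁) (Lt-skip⁺ p l₂)
  ; no231  = λ h<i i<j j<k l₁ l₂ → no231 g (mono h<i) (mono i<j) (mono j<k) (Lt-skip⁺ p l₁) (Lt-skip⁺ p l₂)
  ; no1∣32 = λ i<h h<j j<k l₁ l₂ → no1∣32 g (mono i<h) (mono h<j) (mono j<k) (Lt-skip⁺ p l₁) (Lt-skip⁺ p l₂)
  ; no13∣2 = λ i<j j<h h<k l₁ l₂ → no13∣2 g (mono i<j) (mono j<h) (mono h<k) (Lt-skip⁺ p l₁) (Lt-skip⁺ p l₂)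
  }
  where
  mono : i < j → skip p i < skip p j
  mono = skip-mono-< p

Good-addMax⇒Valid : {w : Word m n} → p ≤ n → Good (addMax p w) (skip p h) → Valid w h p
Good-addMax⇒Valid {p = p} p≤n g = record
  { bound  = p≤n
  ; no12∣  = λ { p≤h i<j j<p l@(_ , _ , _ , b , _) →
      no123 g (skip-mono-< p i<j) (skip-<⁺ j<p) (skip->⁺ p≤h) (Lt-skip⁺ p l) (Lt-max⁺ p≤n b) }
  ; no1∣2ˡ = λ { p≤h i<p h<k l@(_ , _ , _ , b , _) →
      no13∣2 g (skip-<⁺ i<p) (skip->⁺ p≤h) (skip-mono-< p h<k) (Lt-skip⁺ p l) (Lt-max⁺ p≤n b) }
  ; no1∣2ʳ = λ { h<p i<h p≤k l@(_ , _ , _ , b , _) →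
      no1∣32 g (skip-mono-< p i<h) (skip-<⁺ h<p) (skip->⁺ p≤k) (Lt-skip⁺ p l) (Lt-max⁺ p≤n b) }
  ; no2∣1  = λ { h<p h<i i<p p≤k l@(_ , _ , _ , b , _) →
      no231 g (skip-mono-< p h<i) (skip-<⁺ i<p) (skip->⁺ p≤k) (Lt-skip⁺ p l) (Lt-max⁺ p≤n b) }
  }

-- Evolution of sites under insertion.

-- The site q′ of addMax p w comes from the site q of w. For q = p there are two such sites q′,
-- one on either side of the maximum.
record Aligned (p q q′ : ℕ) : Set where
  field
    before : i < q → skip p i < q′
    after  : q ≤ i → q′ ≤ skip p i

  before⁻ : skip p i < q′ → i < q
  before⁻ lt = ≰⇒> λ q≤i → <⇒≱ lt (after q≤i)

  after⁻ : q′ ≤ skip p i → q ≤ i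
  after⁻ le = ≮⇒≥ λ i<q → ≤⇒≯ le (before i<q)

open Aligned

aligned-≤ : q ≤ p → Aligned p q q
aligned-≤ {q} {p} q≤p = record
  { before = λ i<q → subst (_< q) (sym (skip-below (<-≤-trans i<q q≤p))) i<q
  ; after  = λ {i} q≤i → ≤-trans q≤i (skip-≥ p i) }

aligned-≥ : p ≤ q → Aligned p q (suc q)
aligned-≥ {p} {q} p≤q = record
  { before = λ i<q → subst (skip p _ <_) (skip-above p≤q) (skip-mono-< p i<q)
  ; after  = λ q≤i → subst (_≤ skip p _) (skip-above p≤q) (skip-mono-≤ p q≤i) }

-- Obstructions persist, so valid sites of the child come from valid sites of the parent.
Valid-addMax⁻ : ∀ {q′} {w : Word m n} → Aligned p q q′ → q ≤ n →
                Valid (addMax p w) (skip p h) q′ → Valid w h q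
Valid-addMax⁻ {p = p} al q≤n v = record
  { bound  = q≤n
  ; no12∣  = λ q≤h i<j j<q l → no12∣ v (after al q≤h) (skip-mono-< p i<j) (before al j<q) (Lt-skip⁺ p l)
  ; no1∣2ˡ = λ q≤h i<q h<k l → no1∣2ˡ v (after al q≤h) (before al i<q) (skip-mono-< p h<k) (Lt-skip⁺ p l)
  ; no1∣2ʳ = λ h<q i<h q≤k l → no1∣2ʳ v (before al h<q) (skip-mono-< p i<h) (after al q≤k) (Lt-skip⁺ p l)
  ; no2∣1  = λ h<q h<i i<q q≤k l → no2∣1 v (before al h<q) (skip-mono-< p h<i) (before al i<q) (after al q≤k) (Lt-skip⁺ p l)
  }

-- An obstruction that avoids the maximum already lies in `w`. The maximum cannot be its smaller
-- letter, and the four function hypotheses before `Valid w h q` rule it out as the larger one, one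
-- for each field of `Valid` after `bound`.
Valid-addMax⁺ : ∀ {q′} {w : Word m n} → p ≤ n → Aligned p q q′ → q′ ≤ suc n →
  (∀ {i} → q′ ≤ skip p h → i < p → ¬ p < q′) →
  (∀ {i} → q′ ≤ skip p h → i < q′ → ¬ skip p h < p) →
  (∀ {i} → skip p h < q′ → i < skip p h → ¬ q′ ≤ p) →
  (skip p h < p → ¬ p < q′) →
  Valid w h q → Valid (addMax p w) (skip p h) q′
Valid-addMax⁺ {p = p} {h = h} {q′ = q′} {w = w} p≤n al q′≤n e₁ e₂ e₃ e₄ v =
  record { bound = q′≤n ; no12∣ = a ; no1∣2ˡ = b ; no1∣2ʳ = c ; no2∣1 = d }
  where
  a : q′ ≤ skip p h → i < j → j < q′ → ¬ Lt (addMax p w) i j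
  a {i} {j} q≤h i<j j<q l with skipView p i | skipView p j
  ... | gap       | _         = Lt-max⁻ p≤n l
  ... | skipped i | gap       = e₁ q≤h i<j j<q
  ... | skipped i | skipped j = no12∣ v (after⁻ al q≤h) (skip-cancel-< p i<j) (before⁻ al j<q) (Lt-skip⁻ p≤n l)
  b : q′ ≤ skip p h → i < q′ → skip p h < k → ¬ Lt (addMax p w) i k
  b {i} {k} q≤h i<q h<k l with skipView p i | skipView p k
  ... | gap       | _         = Lt-max⁻ p≤n l
  ... | skipped i | gap       = e₂ q≤h i<q h<k
  ... | skipped i | skipped k = no1∣2ˡ v (after⁻ al q≤h) (before⁻ al i<q) (skip-cancel-< p h<k) (Lt-skip⁻ p≤n l)
  c : skip p h < q′ → i < skip p h → q′ ≤ k → ¬ Lt (addMax p w) i k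
  c {i} {k} h<q i<h q≤k l with skipView p i | skipView p k
  ... | gap       | _         = Lt-max⁻ p≤n l
  ... | skipped i | gap       = e₃ h<q i<h q≤k
  ... | skipped i | skipped k = no1∣2ʳ v (before⁻ al h<q) (skip-cancel-< p i<h) (after⁻ al q≤k) (Lt-skip⁻ p≤n l)
  d : skip p h < q′ → skip p h < i → i < q′ → q′ ≤ k → ¬ Lt (addMax p w) k i
  d {i} {k} h<q h<i i<q q≤k l with skipView p i | skipView p k
  ... | _         | gap       = Lt-max⁻ p≤n l
  ... | gap       | skipped k = e₄ h<i i<q
  ... | skipped i | skipped k = no2∣1 v (before⁻ al h<q) (skip-cancel-< p h<i) (before⁻ al i<q) (after⁻ al q≤k) (Lt-skip⁻ p≤n l)

Valid-zero : {w : Word m n} → Valid w h 0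
Valid-zero = record
  { bound = z≤n ; no12∣ = λ _ _ () ; no1∣2ˡ = λ _ () ; no1∣2ʳ = λ () ; no2∣1 = λ () }

Valid-end : {w : Word m n} → h < n → Valid w h n
Valid-end h<n = record
  { bound  = ≤-refl
  ; no12∣  = λ n≤h → contradiction h<n (≤⇒≯ n≤h)
  ; no1∣2ˡ = λ n≤h → contradiction h<n (≤⇒≯ n≤h)
  ; no1∣2ʳ = λ { _ _ n≤k (_ , _ , _ , b , _) → <⇒≱ (At⇒< b) n≤k }
  ; no2∣1  = λ { _ _ _ n≤k (_ , _ , a , _) → <⇒≱ (At⇒< a) n≤k }
  }

-- Labels as descriptions of valid sites.

hole : Label → ℕ
hole (front _)     = 0
hole (later h _ _) = suc h

reach : Label → ℕ
reach (front _)     = 0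
reach (later _ r _) = r

cuts : Label → List ℕ
cuts (front qs)     = qs
cuts (later _ _ qs) = qs

-- The conditions on a left site bear on the prefix before it and so pass to smaller sites; hence
-- one number `reach` suffices there. A right site must split `B` into B₁ < B₂, which is not
-- monotone in the site, so these are listed, as offsets `q` of `suc (hole t + q)`.
record Labels {m} (t : Label) (w : Word m (suc m)) : Set where
  field
    atHole     : At w (hole t) nothing
    uniqueHole : At w i nothing → i ≡ hole t
    good       : Good w (hole t)
    left       : ∀ p → p ≤ reach t ⇔ (p ≤ hole t × Valid w (hole t) p)
    right      : ∀ q → q ∈ cuts t ⇔ Valid w (hole t) (suc (hole t + q))
    descending : AllPairs _>_ (cuts t)

  hole≤ : hole t ≤ m
  hole≤ = s≤s⁻¹ (At⇒< atHole)

  value : i ≤ m → i ≢ hole t → ∃ λ x → At w i (just x)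
  value i≤m i≢h with At-total w (s≤s i≤m)
  ... | just x  , a = x , a
  ... | nothing , a = contradiction (uniqueHole a) i≢h

open Labels

module _ {w : Word m (suc m)} (l : Labels t w) (v : Valid w (hole t) p) where

  private
    ◇ = hole t
    w′ = addMax p w

  addMax-uniqueHole : At w′ i nothing → i ≡ skip p ◇
  addMax-uniqueHole {i} a with skipView p i
  ... | skipped i = cong (skip p) (uniqueHole l (At-skip⁻ (bound v) a))
  ... | gap with At-functional a (At-max⁺ w (bound v))
  ...   | ()

  -- A maximum before a left site obstructs it once some entry precedes the maximum, which cannot
  -- happen for `p ≡ 0`. A right site looks left of the hole only for letters smaller than one after
  -- the site, and the maximum is none.
  leftward : p ≤ ◇ → p ≡ 0 ⊎ ◇ < q → Valid w ◇ q → Valid w′ (suc ◇) (suc q)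
  leftward {q} p≤h c vq = subst (λ h′ → Valid w′ h′ (suc q)) sh
    (Valid-addMax⁺ (bound v) (aligned-≥ p≤q) (s≤s (bound vq))
      (λ q≤h i<p _ → e₁ c (s≤s⁻¹ (subst (suc q ≤_) sh q≤h)) i<p)
      (λ _ _ h<p → <-asym h<p (skip->⁺ p≤h))
      (λ h<q _ q≤p → <⇒≱ (<-≤-trans h<q q≤p) (<⇒≤ (skip->⁺ p≤h)))
      (λ h<p _ → <-asym h<p (skip->⁺ p≤h))
      vq)
    where
    sh = skip-above p≤h
    p≤q : p ≤ q
    p≤q = [ (λ p≡0 → subst (_≤ q) (sym p≡0) z≤n) , (λ h<q → ≤-trans p≤h (<⇒≤ h<q)) ]′ c
    e₁ : p ≡ 0 ⊎ ◇ < q → q ≤ ◇ → ¬ i < p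
    e₁ (inj₁ p≡0) _ i<p = n≮0 (subst (_ <_) p≡0 i<p)
    e₁ (inj₂ h<q)  q≤h _ = <⇒≱ h<q q≤h

  leftward⁻ : p ≤ ◇ → p ≤ q → Valid w′ (suc ◇) (suc q) → Valid w ◇ q
  leftward⁻ {q} p≤h p≤q v′ = Valid-addMax⁻ (aligned-≥ p≤q) (s≤s⁻¹ (bound v′))
    (subst (λ h′ → Valid w′ h′ (suc q)) (sym (skip-above p≤h)) v′)

  -- Hole and site both move by one, so the offsets stay the same.
  leftward-right : p ≤ ◇ → ∀ q → q ∈ cuts t ⇔ Valid w′ (suc ◇) (suc (suc ◇ + q))
  leftward-right p≤h q = mk⇔
    (λ q∈ → leftward p≤h (inj₂ h<s) (to (right l q) q∈))
    (λ v′ → from (right l q) (leftward⁻ p≤h (≤-trans p≤h (<⇒≤ h<s)) v′))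
    where
    h<s : ◇ < suc (◇ + q)
    h<s = s≤s (m≤m+n ◇ q)

-- Nothing precedes the maximum, so it ends no ascent: all old left sites survive, shifted by one,
-- and site 0 is additional.
Labels-leftmost : {w : Word m (suc m)} → Labels t w →
                  Labels (later (hole t) (suc (reach t)) (cuts t)) (addMax 0 w)
Labels-leftmost {t = t} {w = w} l = record
  { atHole     = At-skip⁺ 0 (atHole l)
  ; uniqueHole = addMax-uniqueHole l Valid-zero
  ; good       = Good-addMax⁺ (good l) Valid-zero
  ; left       = reachable
  ; right      = leftward-right l Valid-zero z≤n
  ; descending = descending l
  }
  where
  reachable : ∀ q → q ≤ suc (reach t) ⇔ (q ≤ suc (hole t) × Valid (addMax 0 w) (suc (hole t)) q)
  reachable zero    = mk⇔ (λ _ → z≤n , Valid-zero) (λ _ → z≤n)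
  reachable (suc q) = mk⇔
    (λ q≤r → let q≤h , vq = to (left l q) (s≤s⁻¹ q≤r) in
             s≤s q≤h , leftward l Valid-zero z≤n (inj₁ refl) vq)
    (λ { (q≤h , vq) → s≤s (from (left l q) (s≤s⁻¹ q≤h , leftward⁻ l Valid-zero z≤n z≤n vq)) })

-- Sites up to the maximum survive. Between it and the hole, the first entry and the maximum form an
-- ascent before the site; the first entry is not the hole because `suc p ≤ hole t`.
Labels-left : {w : Word m (suc m)} → Labels t w → suc p ≤ reach t →
              Labels (later (hole t) (suc p) (cuts t)) (addMax (suc p) w)
Labels-left {m = m} {t = t} {p = p} {w = w} l p≤r = record
  { atHole     = subst (λ h′ → At (addMax (suc p) w) h′ nothing) sh (At-skip⁺ (suc p) (atHole l))
  ; uniqueHole = λ a → trans (addMax-uniqueHole l v a) sh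
  ; good       = subst (Good (addMax (suc p) w)) sh (Good-addMax⁺ (good l) v)
  ; left       = λ q → mk⇔ sound complete
  ; right      = leftward-right l v p≤h
  ; descending = descending l
  }
  where
  ◇ = hole t
  p≤h = proj₁ (to (left l (suc p)) p≤r)
  v = proj₂ (to (left l (suc p)) p≤r)
  sh : skip (suc p) ◇ ≡ suc ◇
  sh = skip-above p≤h
  sound : q ≤ suc p → q ≤ suc ◇ × Valid (addMax (suc p) w) (suc ◇) q
  sound {q} q≤p = ≤-trans q≤h (n≤1+n ◇) , subst (λ h′ → Valid (addMax (suc p) w) h′ q) sh
    (Valid-addMax⁺ (bound v) (aligned-≤ q≤p) (≤-trans q≤p (≤-trans (bound v) (n≤1+n _)))
      (λ _ _ p<q → <⇒≱ p<q q≤p)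
      (λ _ _ h<p → <-asym h<p (skip->⁺ p≤h))
      (λ h<q _ _ → <⇒≱ (<-≤-trans h<q q≤p) (<⇒≤ (skip->⁺ p≤h)))
      (λ h<p _ → <-asym h<p (skip->⁺ p≤h))
      (proj₂ (to (left l q) (≤-trans q≤p p≤r))))
    where
    q≤h = ≤-trans q≤p p≤h
  complete : q ≤ suc ◇ × Valid (addMax (suc p) w) (suc ◇) q → q ≤ suc p
  complete {q} (q≤h , vq) = ≮⇒≥ λ p<q →
    no12∣ vq q≤h z<s p<q (Lt-max⁺ (bound v) (proj₂ (value l z≤n (<⇒≢ (<-≤-trans z<s p≤h)))))

module _ {w : Word m (suc m)} (l : Labels t w) (v : Valid w (hole t) p) (h<p : hole t < p) where

  private
    ◇ = hole t
    w′ = addMax p w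
    sh : skip p ◇ ≡ ◇
    sh = skip-below h<p

  rightward-atHole : At w′ ◇ nothing
  rightward-atHole = subst (λ h′ → At w′ h′ nothing) sh (At-skip⁺ p (atHole l))

  rightward-uniqueHole : At w′ i nothing → i ≡ ◇
  rightward-uniqueHole a = trans (addMax-uniqueHole l v a) sh

  rightward-good : Good w′ ◇
  rightward-good = subst (Good w′) sh (Good-addMax⁺ (good l) v)

  -- At a positive site up to the hole, the first entry precedes the site and is smaller than the
  -- maximum beyond the hole, against `no1∣2ˡ`.
  rightward-left : ∀ q → q ≤ 0 ⇔ (q ≤ ◇ × Valid w′ ◇ q)
  rightward-left zero    = mk⇔ (λ _ → z≤n , Valid-zero) (λ _ → z≤n)
  rightward-left (suc q) = mk⇔ (λ ()) λ { (q<h , vq) → contradiction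
    (Lt-max⁺ (bound v) (proj₂ (value l z≤n (<⇒≢ (<-≤-trans z<s q<h)))))
    (subst (λ i → ¬ Lt w′ i p) (sym (skip-below (<-≤-trans z<s h<p))) (no1∣2ˡ vq q<h z<s h<p)) }

  -- After the maximum, only the last site survives: elsewhere the maximum and the last
  -- entry form an inversion straddling the site.
  rightward-end : Valid w′ ◇ q → p < q → q ≡ suc (suc m)
  rightward-end {q} vq p<q with m≤n⇒m<n∨m≡n (bound vq)
  ... | inj₂ eq   = eq
  ... | inj₁ q<2+m = contradiction
    (Lt-max⁺ (bound v) (proj₂ (value l ≤-refl (λ m≡h → <⇒≢ (<-≤-trans h<p p≤m) (sym m≡h)))))
    (subst (λ k → ¬ Lt w′ k p) (sym (skip-above p≤m))
      (no2∣1 vq (<-trans h<p p<q) h<p p<q (s≤s⁻¹ q<2+m)))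
    where
    p≤m : p ≤ m
    p≤m = s≤s⁻¹ (≤-trans p<q (s≤s⁻¹ q<2+m))

-- As `A` is non-empty, a site between the hole and the maximum has the maximum after it and a
-- smaller first entry left of the hole, against `no1∣2ʳ`. Beyond the maximum, `rightward-end`
-- leaves only the final site.
Labels-right : ∀ {h r qs} {w : Word m (suc m)} → Labels (later h r qs) w → q ∈ qs →
               Labels (later h 0 (m ∸ h ∷ [])) (addMax (suc (suc h + q)) w)
Labels-right {m = m} {q = q₀} {h = h} {r = r} {qs = qs} {w = w} l q∈ = record
  { atHole     = rightward-atHole l v h<s
  ; uniqueHole = rightward-uniqueHole l v h<s
  ; good       = rightward-good l v h<s
  ; left       = rightward-left l v h<s
  ; right      = λ q → mk⇔ (λ { (here refl) → subst (Valid w′ (suc h)) (sym end) (Valid-end (s≤s hole≤′)) }) complete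
  ; descending = [] ∷ []
  }
  where
  site = suc (suc h + q₀)
  w′ = addMax site w
  v = to (right l q₀) q∈
  h<s : suc h < site
  h<s = s≤s (m≤m+n (suc h) q₀)
  hole≤′ : suc h ≤ suc m
  hole≤′ = ≤-trans (hole≤ l) (n≤1+n m)
  end : suc (suc h + (m ∸ h)) ≡ suc (suc m)
  end = cong (suc ∘ suc) (m+[n∸m]≡n (≤-trans (n≤1+n h) (hole≤ l)))
  complete : Valid w′ (suc h) (suc (suc h + q)) → q ∈ m ∸ h ∷ []
  complete {q} vq with suc (suc h + q) ≤? site
  ... | no  q≰s = here (+-cancelˡ-≡ (suc (suc h)) q (m ∸ h)
                        (trans (rightward-end l v h<s vq (≰⇒> q≰s)) (sym end)))
  ... | yes q≤s = contradiction
    (Lt-max⁺ (bound v) (proj₂ (value l {i = 0} z≤n (λ ()))))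
    (no1∣2ʳ vq (s≤s (m≤m+n (suc h) q)) z<s q≤s)

-- As `A` is empty, nothing straddles the hole and the cuts up to `q` survive. Past the maximum only
-- the end remains, whose cut is `suc m`. The full list `ps` is kept apart from `q ∷ qs` because
-- `frontMoves` recurses through its tails.
Labels-front : ∀ {ps qs} {w : Word m (suc m)} → Labels (front ps) w → q ∈ ps →
               (∀ {k} → k ∈ q ∷ qs ⇔ (k ∈ ps × k ≤ q)) → AllPairs _>_ (q ∷ qs) →
               Labels (front (suc m ∷ q ∷ qs)) (addMax (suc q) w)
Labels-front {m = m} {q = q₀} {ps = ps} {qs = qs} {w = w} l q∈ sel desc = record
  { atHole     = rightward-atHole l v z<s
  ; uniqueHole = rightward-uniqueHole l v z<s
  ; good       = rightward-good l v z<s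
  ; left       = rightward-left l v z<s
  ; right      = λ q → mk⇔ sound complete
  ; descending = All.tabulate (λ {k} k∈ → s≤s (≤-trans (proj₂ (to sel k∈)) (s≤s⁻¹ (bound v)))) ∷ desc
  }
  where
  w′ = addMax (suc q₀) w
  v = to (right l q₀) q∈
  sound : q ∈ suc m ∷ q₀ ∷ qs → Valid w′ 0 (suc q)
  sound (here refl) = Valid-end z<s
  sound {q} (there q∈) with to sel q∈
  ... | q∈ps , q≤q₀ = Valid-addMax⁺ (bound v) (aligned-≤ (s≤s q≤q₀)) (≤-trans (s≤s q≤q₀) (≤-trans (bound v) (n≤1+n _)))
    (λ ()) (λ ()) (λ _ ()) (λ _ p<q → <⇒≱ p<q (s≤s q≤q₀)) (to (right l q) q∈ps)
  complete : Valid w′ 0 (suc q) → q ∈ suc m ∷ q₀ ∷ qs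
  complete {q} vq with suc q ≤? suc q₀
  ... | no  s≰p = here (suc-injective (rightward-end l v z<s vq (≰⇒> s≰p)))
  ... | yes s≤p = there (from sel
    (from (right l q) (Valid-addMax⁻ (aligned-≤ s≤p) (≤-trans s≤p (bound v)) vq) , s≤s⁻¹ s≤p))

-- Correspondence of moves and valid sites.

Sound : Word m (suc m) → ℕ × Label → Set
Sound {m} w (p , t) = p ≤ suc m × Labels t (addMax p w)

moves-sound : {w : Word m (suc m)} → Labels t w → All (Sound w) (moves m t)
moves-sound {m = m} {t = front ps} {w = w} l =
  (z≤n , Labels-leftmost l) ∷ fronts ps (descending l) (λ k → k) (λ k∈ps _ _ → k∈ps)
  where
  -- The last two hypotheses keep `qs` a downward closed part of `ps`, so that a suffix `q ∷ qs`
  -- consists of exactly the cuts up to `q`.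
  fronts : ∀ qs → AllPairs _>_ qs → (∀ {k} → k ∈ qs → k ∈ ps) →
           (∀ {k q} → k ∈ ps → q ∈ qs → k ≤ q → k ∈ qs) → All (Sound w) (frontMoves m qs)
  fronts []       _              _   _   = []
  fronts (q ∷ qs) (q>qs ∷ desc) sub low =
    (bound (to (right l q) (sub (here refl))) ,
     Labels-front l (sub (here refl)) (mk⇔ (λ k∈ → sub k∈ , below k∈) (λ { (k∈ps , k≤q) → low k∈ps (here refl) k≤q }))
       (q>qs ∷ desc))
    ∷ fronts qs desc (sub ∘ there) λ k∈ps q′∈ k≤q′ → tail q′∈ k≤q′ (low k∈ps (there q′∈) k≤q′)
    where
    below : k ∈ q ∷ qs → k ≤ q
    below (here refl) = ≤-refl
    below (there k∈)  = <⇒≤ (All.lookup q>qs k∈)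
    tail : ∀ {q′} → q′ ∈ qs → k ≤ q′ → k ∈ q ∷ qs → k ∈ qs
    tail q′∈ k≤q′ (here refl) = contradiction k≤q′ (<⇒≱ (All.lookup q>qs q′∈))
    tail q′∈ k≤q′ (there k∈)  = k∈
moves-sound {m = m} {t = later h r qs} {w = w} l =
  (z≤n , Labels-leftmost l) ∷ All.++⁺ (lefts r ≤-refl)
    (All.map⁺ (All.tabulate λ {q} q∈ → bound (to (right l q) q∈) , Labels-right l q∈))
  where
  lefts : ∀ p → p ≤ r → All (Sound w) (leftMoves h qs p)
  lefts zero    p≤r = []
  lefts (suc p) p≤r =
    (bound (proj₂ (to (left l (suc p)) p≤r)) , Labels-left l p≤r) ∷ lefts p (≤-trans (n≤1+n p) p≤r)

leftMoves-complete : ∀ h qs r → suc p ≤ r → (suc p , later (suc h) (suc p) qs) ∈ leftMoves h qs r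
leftMoves-complete h qs (suc r) p≤r with m≤n⇒m<n∨m≡n p≤r
... | inj₁ p<r  = there (leftMoves-complete h qs r (s≤s⁻¹ p<r))
... | inj₂ refl = here refl

frontMoves-complete : ∀ m {qs} → q ∈ qs → ∃ λ t → (suc q , t) ∈ frontMoves m qs
frontMoves-complete m (here refl) = _ , here refl
frontMoves-complete m (there q∈)  with frontMoves-complete m q∈
... | t , t∈ = t , there t∈

moves-complete : {w : Word m (suc m)} → Labels t w → Valid w (hole t) p → ∃ λ t′ → (p , t′) ∈ moves m t
moves-complete {t = front qs}     {p = zero} l v = _ , here refl
moves-complete {t = later h r qs} {p = zero} l v = _ , here refl
moves-complete {m = m} {t = front qs} {p = suc p} l v
  with frontMoves-complete m (from (right l p) v)
... | t , t∈ = t , there t∈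
moves-complete {m = m} {t = later h r qs} {p = suc p} l v with suc p ≤? suc h
... | yes p≤h = _ , there (∈-++⁺ˡ (leftMoves-complete h qs r (from (left l (suc p)) (p≤h , v))))
... | no  p≰h with m≤n⇒∃[o]m+o≡n (≰⇒> p≰h)
...   | q , refl = _ , there (∈-++⁺ʳ (leftMoves h qs r) (∈-map⁺ _ (from (right l q) v)))

Distinct : ℕ × Label → ℕ × Label → Set
Distinct a b = proj₁ a ≢ proj₁ b

moves-distinct : {w : Word m (suc m)} → Labels t w → AllPairs Distinct (moves m t)
moves-distinct {m = m} {t = front ps} l = positive ps ∷ fronts ps (descending l)
  where
  positive : ∀ qs → All (Distinct (0 , later 0 1 ps)) (frontMoves m qs)
  positive []       = []
  positive (q ∷ qs) = (λ ()) ∷ positive qs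
  smaller : ∀ qs → All (q >_) qs → All (λ b → suc q ≢ proj₁ b) (frontMoves m qs)
  smaller []       []          = []
  smaller (q ∷ qs) (q< ∷ qs<) = (λ eq → >⇒≢ q< (suc-injective eq)) ∷ smaller qs qs<
  fronts : ∀ qs → AllPairs _>_ qs → AllPairs Distinct (frontMoves m qs)
  fronts []       []            = []
  fronts (q ∷ qs) (q>qs ∷ desc) = smaller qs q>qs ∷ fronts qs desc
moves-distinct {m = m} {t = later h r qs} {w = w} l =
  All.++⁺ (All.map (λ b eq → <⇒≢ (proj₁ b) eq) (lefts< r ≤-refl)) (All.map (λ s<b eq → <⇒≢ (<-trans z<s s<b) eq) rights>)
  ∷ AllPairs.++⁺ (lefts r)
      (AllPairs.map⁺ (AllPairs.map (λ a>b eq → >⇒≢ a>b (+-cancelˡ-≡ (suc (suc h)) _ _ eq)) (descending l)))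
      (All.map (λ b → All.map (λ s<b → <⇒≢ (≤-<-trans (≤-trans (proj₂ b) r≤h) s<b)) rights>) (lefts< r ≤-refl))
  where
  r≤h : r ≤ suc h
  r≤h = proj₁ (to (left l r) ≤-refl)
  rights> : All (λ b → suc h < proj₁ b) (rightMoves m h qs)
  rights> = All.map⁺ (All.universal (λ q → s≤s (m≤m+n (suc h) q)) qs)
  lefts< : ∀ p {k} → p ≤ k → All (λ b → 0 < proj₁ b × proj₁ b ≤ k) (leftMoves h qs p)
  lefts< zero    p≤k = []
  lefts< (suc p) p≤k = (z<s , p≤k) ∷ lefts< p (≤-trans (n≤1+n p) p≤k)
  lefts : ∀ p → AllPairs Distinct (leftMoves h qs p)
  lefts zero    = []
  lefts (suc p) = All.map (λ b → >⇒≢ (s≤s (proj₂ b))) (lefts< p ≤-refl) ∷ lefts p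

-- Letter counts under insertion.

module _ {A B : Set} {P : Pred A 0ℓ} {Q : Pred B 0ℓ} (P? : Decidable P) (Q? : Decidable Q) where

  count-map : (f : A → B) → (∀ y → Q (f y) ⇔ P y) → (ys : Vec A n) → count Q? (Vec.map f ys) ≡ count P? ys
  count-map f Q⇔P []       = refl
  count-map f Q⇔P (y ∷ ys)
    rewrite does-⇔ (Q⇔P y) (Q? (f y)) (P? y) | count-map f Q⇔P ys = refl

-- Two predicates allow one statement to cover an old letter and, with the empty predicate on `w`,
-- the maximum itself.
count-addMax : {P : Pred (Entry m) 0ℓ} {Q : Pred (Entry (suc m)) 0ℓ} (P? : Decidable P) (Q? : Decidable Q) →
               (∀ y → Q (raise y) ⇔ P y) → ∀ p (w : Word m n) →
               count Q? (addMax p w) ≡ (if does (Q? (just (fromℕ m))) then suc else id) (count P? w)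
count-addMax P? Q? Q⇔P zero    w       rewrite count-map P? Q? raise Q⇔P w = refl
count-addMax P? Q? Q⇔P (suc p) []      = refl
count-addMax {m = m} P? Q? Q⇔P (suc p) (y ∷ w)
  rewrite does-⇔ (Q⇔P y) (Q? (raise y)) (P? y) | count-addMax P? Q? Q⇔P p w
  with does (P? y) | does (Q? (just (fromℕ m)))
... | true  | true  = refl
... | true  | false = refl
... | false | true  = refl
... | false | false = refl

raise-injective : {y z : Entry m} → raise y ≡ raise z → y ≡ z
raise-injective = Maybe.map-injective Fin.inject₁-injective

raise≢max : (y : Entry m) → raise y ≢ just (fromℕ m)
raise≢max (just a) eq = Fin.fromℕ≢inject₁ (sym (just-injective eq))

unraise : (y : Entry (suc m)) → y ≢ just (fromℕ m) → ∃ λ z → y ≡ raise z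
unraise nothing  y≢max = nothing , refl
unraise (just a) y≢max with view a
... | ‵fromℕ         = contradiction refl y≢max
... | ‵inj₁ {i = b} _ = just b , refl

count-none : {A : Set} (ys : Vec A n) → count {P = λ _ → ⊥} (λ _ → no id) ys ≡ 0
count-none []       = refl
count-none (y ∷ ys) = count-none ys

count-old : ∀ p (w : Word m n) z → count (_≟ᵉ raise z) (addMax p w) ≡ count (_≟ᵉ z) w
count-old {m = m} p w z
  rewrite count-addMax (_≟ᵉ z) (_≟ᵉ raise z) (λ y → mk⇔ raise-injective (cong raise)) p w
  with just (fromℕ m) ≟ᵉ raise z
... | yes eq = contradiction (sym eq) (raise≢max z)
... | no  _  = refl

count-max : ∀ p (w : Word m n) → count (_≟ᵉ just (fromℕ m)) (addMax p w) ≡ 1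
count-max {m = m} p w
  rewrite count-addMax (λ _ → no id) (_≟ᵉ just (fromℕ m)) (λ y → mk⇔ (raise≢max y) ⊥-elim) p w
        | count-none w | dec-true (fromℕ m Fin.≟ fromℕ m) refl = refl

IsPartialPerm1-addMax⁺ : ∀ p {w : Word m (suc m)} → IsPartialPerm1 w → IsPartialPerm1 (addMax p w)
IsPartialPerm1-addMax⁺ {m = m} p {w} (holes , values) = trans (count-old p w nothing) holes , values′
  where
  values′ : ∀ k → count (_≟ᵉ just k) (addMax p w) ≡ 1
  values′ k with view k
  ... | ‵fromℕ         = count-max p w
  ... | ‵inj₁ {i = b} _ = trans (count-old p w (just b)) (values b)

IsPartialPerm1-addMax⁻ : ∀ p {w : Word m (suc m)} → IsPartialPerm1 (addMax p w) → IsPartialPerm1 w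
IsPartialPerm1-addMax⁻ p {w} (holes , values) =
  trans (sym (count-old p w nothing)) holes , λ k → trans (sym (count-old p w (just k))) (values (inject₁ k))

count-max≡0 : (w : Word (suc m) n) → count (_≟ᵉ just (fromℕ m)) w ≡ 0 → ∃ λ v → w ≡ Vec.map raise v
count-max≡0 []      _ = [] , refl
count-max≡0 {m = m} (y ∷ w) c with y ≟ᵉ just (fromℕ m)
... | no y≢max with unraise y y≢max | count-max≡0 w c
...   | z , refl | v , refl = z ∷ v , refl

removeMax : (w : Word (suc m) (suc n)) → count (_≟ᵉ just (fromℕ m)) w ≡ 1 →
            ∃₂ λ p v → p ≤ n × w ≡ addMax p v
removeMax {m = m} (y ∷ w) c with y ≟ᵉ just (fromℕ m)
removeMax (y ∷ w)     c | yes refl with count-max≡0 w (suc-injective c)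
... | v , refl = 0 , v , z≤n , refl
removeMax {n = zero}  (y ∷ []) () | no _
removeMax {n = suc n} (y ∷ w) c | no y≢max with unraise y y≢max | removeMax w c
... | z , refl | p , v , p≤n , refl = suc p , z ∷ v , s≤s p≤n , refl

map-raise-injective : {v w : Word m n} → Vec.map raise v ≡ Vec.map raise w → v ≡ w
map-raise-injective {v = []}    {[]}    eq = refl
map-raise-injective {v = y ∷ v} {z ∷ w} eq =
  cong₂ _∷_ (raise-injective (Vec.∷-injectiveˡ eq)) (map-raise-injective (Vec.∷-injectiveʳ eq))

-- The only entry outside the image of `raise` marks the site. Distinct sites beyond the end would
-- give equal words, whence the bounds.
addMax-injective : ∀ {p q} {v w : Word m n} → p ≤ n → q ≤ n → addMax p v ≡ addMax q w → p ≡ q × v ≡ w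
addMax-injective {p = zero}  {zero}  _ _ eq = refl , map-raise-injective (Vec.∷-injectiveʳ eq)
addMax-injective {p = zero}  {suc q} {w = y ∷ w} _ _ eq = contradiction (sym (Vec.∷-injectiveˡ eq)) (raise≢max y)
addMax-injective {p = suc p} {zero}  {v = y ∷ v} _ _ eq = contradiction (Vec.∷-injectiveˡ eq) (raise≢max y)
addMax-injective {p = suc p} {suc q} {y ∷ v} {z ∷ w} p≤n q≤n eq
  with addMax-injective (s≤s⁻¹ p≤n) (s≤s⁻¹ q≤n) (Vec.∷-injectiveʳ eq)
... | p≡q , v≡w = cong suc p≡q , cong₂ _∷_ (raise-injective (Vec.∷-injectiveˡ eq)) v≡w

-- Extensions and forbidden patterns.

lookup⇒At : ∀ (w : Word m n) f → At w (toℕ f) (Maybe.map toℕ (lookup w f))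
lookup⇒At (y ∷ w) Fin.zero    = here refl
lookup⇒At (y ∷ w) (Fin.suc f) = there (lookup⇒At w f)

At⇒lookup : ∀ {w : Word m n} {e} → At w i e → ∃ λ f → toℕ f ≡ i × Maybe.map toℕ (lookup w f) ≡ e
At⇒lookup (here eq) = Fin.zero , refl , eq
At⇒lookup (there a) with At⇒lookup a
... | f , f≡i , eq = Fin.suc f , cong suc f≡i , eq

At-hole⇒lookup : {w : Word m n} → At w i nothing → ∃ λ f → toℕ f ≡ i × lookup w f ≡ nothing
At-hole⇒lookup {w = w} a with At⇒lookup a
... | f , f≡i , eq with lookup w f in lookup≡
...   | nothing = f , f≡i , lookup≡

At-value⇒lookup : {w : Word m n} → At w i (just x) → ∃₂ λ f a → toℕ f ≡ i × toℕ a ≡ x × lookup w f ≡ just a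
At-value⇒lookup {w = w} a with At⇒lookup a
... | f , f≡i , eq with lookup w f in lookup≡
...   | just b = f , b , f≡i , just-injective eq , lookup≡

-- The extension in which the hole receives the value v.
module FillHole (v : Fin (suc m)) (w : Word m (suc m)) where

  fillEntry : Entry m → Fin (suc m)
  fillEntry = maybe′ (punchIn v) v

  fill : Vec (Fin (suc m)) (suc m)
  fill = Vec.map fillEntry w

  private variable
    f g : Fin (suc m)
    a b : Fin m

  lookup-fill : ∀ {y} → lookup w f ≡ y → lookup fill f ≡ fillEntry y
  lookup-fill {f} eq = trans (Vec.lookup-map f fillEntry w) (cong fillEntry eq)

  punchIn-mono-< : a Fin.< b → punchIn v a Fin.< punchIn v b
  punchIn-mono-< {a} {b} a<b = ≰⇒> (λ le → <⇒≱ a<b (Fin.punchIn-cancel-≤ v b a le))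

  punchIn-cancel-< : punchIn v a Fin.< punchIn v b → a Fin.< b
  punchIn-cancel-< {a} {b} lt = ≰⇒> (λ le → <⇒≱ lt (Fin.punchIn-mono-≤ v b a le))

  punchIn-below : ∀ {m} (v : Fin (suc m)) a → toℕ a < toℕ v → punchIn v a Fin.< v
  punchIn-below (Fin.suc v) Fin.zero    a<v = z<s
  punchIn-below (Fin.suc v) (Fin.suc a) a<v = s<s (punchIn-below v a (s≤s⁻¹ a<v))

  punchIn-above : ∀ {m} (v : Fin (suc m)) a → toℕ v ≤ toℕ a → v Fin.< punchIn v a
  punchIn-above Fin.zero    a           v≤a = z<s
  punchIn-above (Fin.suc v) (Fin.suc a) v≤a = s<s (punchIn-above v a (s≤s⁻¹ v≤a))

  fill-mono : lookup w f ≡ just a → lookup w g ≡ just b → a Fin.< b → lookup fill f Fin.< lookup fill g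
  fill-mono wf wg a<b = subst₂ Fin._<_ (sym (lookup-fill wf)) (sym (lookup-fill wg)) (punchIn-mono-< a<b)

  fill-cancel : lookup w f ≡ just a → lookup w g ≡ just b → lookup fill f Fin.< lookup fill g → a Fin.< b
  fill-cancel wf wg lt = punchIn-cancel-< (subst₂ Fin._<_ (lookup-fill wf) (lookup-fill wg) lt)

  fill-below : lookup w f ≡ just a → lookup w g ≡ nothing → toℕ a < toℕ v → lookup fill f Fin.< lookup fill g
  fill-below wf wg a<v = subst₂ Fin._<_ (sym (lookup-fill wf)) (sym (lookup-fill wg)) (punchIn-below v _ a<v)

  fill-above : lookup w f ≡ nothing → lookup w g ≡ just b → toℕ v ≤ toℕ b → lookup fill f Fin.< lookup fill g
  fill-above wf wg v≤b = subst₂ Fin._<_ (sym (lookup-fill wf)) (sym (lookup-fill wg)) (punchIn-above v _ v≤b)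

  fill-isPerm : IsPartialPerm1 w → IsPerm fill
  fill-isPerm (holes , values) k with v Fin.≟ k
  ... | yes refl = trans (count-map (_≟ᵉ nothing) (Fin._≟ v) fillEntry eq w) holes
    where
    eq : ∀ y → fillEntry y ≡ v ⇔ y ≡ nothing
    eq nothing  = mk⇔ (λ _ → refl) (λ _ → refl)
    eq (just a) = mk⇔ (λ pa≡v → contradiction pa≡v (Fin.punchInᵢ≢i v a)) (λ ())
  ... | no v≢k = trans (count-map (_≟ᵉ just (punchOut v≢k)) (Fin._≟ k) fillEntry eq w) (values (punchOut v≢k))
    where
    eq : ∀ y → fillEntry y ≡ k ⇔ y ≡ just (punchOut v≢k)
    eq nothing  = mk⇔ (λ v≡k → contradiction v≡k v≢k) (λ ())
    eq (just a) = mk⇔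
      (λ pa≡k → cong just (Fin.punchIn-injective v a (punchOut v≢k) (trans pa≡k (sym (Fin.punchIn-punchOut v≢k)))))
      (λ { refl → Fin.punchIn-punchOut v≢k })

  fill-isExtension : IsPartialPerm1 w → IsExtension w fill
  fill-isExtension pp = fill-isPerm pp , λ f g a b wf wg → mk⇔ (fill-mono wf wg) (fill-cancel wf wg)

open FillHole using (fill; fill-mono; fill-below; fill-above; fill-isExtension)

-- Each forbidden pattern is 1342 with the letter at the hole removed: in the order of the fields,
-- the 2, 1, 3 and 4. Except for the 4, the hole is filled just below the next larger letter of the
-- occurrence.
Avoids⇒Good : ∀ {h} {w : Word m (suc m)} → IsPartialPerm1 w → Avoids1342 w → At w h nothing → Good w h
Avoids⇒Good {m = m} {h = h} {w = w} pp av atHole with At-hole⇒lookup atHole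
... | fh , refl , wh = record { no123 = a ; no231 = b ; no1∣32 = c ; no13∣2 = d }
  where
  refute : ∀ v → ¬ Contains1342 (fill v w)
  refute v = av (fill v w) (fill-isExtension v w pp)
  a : i < j → j < k → k < toℕ fh → Lt w i j → ¬ Lt w j k
  a i<j j<k k<h (_ , _ , ai , aj , x<y) (_ , _ , aj′ , ak , y<z) with At-functional aj aj′
  ... | refl with At-value⇒lookup ai | At-value⇒lookup aj | At-value⇒lookup ak
  ... | fi , vi , refl , refl , wi | fj , vj , refl , refl , wj | fk , vk , refl , refl , wk =
    refute v (fi , fj , fk , fh , i<j , j<k , k<h ,
      fill-below v w wi wh (subst (toℕ vi <_) (sym v≡) x<y) , fill-above v w wh wj (≤-reflexive v≡) , fill-mono v w wj wk y<z)
    where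
    v = inject₁ vj
    v≡ = Fin.toℕ-inject₁ vj
  b : toℕ fh < i → i < j → j < k → Lt w k i → ¬ Lt w i j
  b h<i i<j j<k (_ , _ , ak , ai , z<x) (_ , _ , ai′ , aj , x<y) with At-functional ai ai′
  ... | refl with At-value⇒lookup ai | At-value⇒lookup aj | At-value⇒lookup ak
  ... | fi , vi , refl , refl , wi | fj , vj , refl , refl , wj | fk , vk , refl , refl , wk =
    refute v (fh , fi , fj , fk , h<i , i<j , j<k ,
      fill-above v w wh wk (≤-reflexive (Fin.toℕ-inject₁ vk)) , fill-mono v w wk wi z<x , fill-mono v w wi wj x<y)
    where
    v = inject₁ vk
  c : i < toℕ fh → toℕ fh < j → j < k → Lt w i k → ¬ Lt w k j
  c i<h h<j j<k (_ , _ , ai , ak , x<z) (_ , _ , ak′ , aj , z<y) with At-functional ak ak′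
  ... | refl with At-value⇒lookup ai | At-value⇒lookup aj | At-value⇒lookup ak
  ... | fi , vi , refl , refl , wi | fj , vj , refl , refl , wj | fk , vk , refl , refl , wk =
    refute v (fi , fh , fj , fk , i<h , h<j , j<k ,
      fill-mono v w wi wk x<z , fill-below v w wk wh (subst (toℕ vk <_) (sym v≡) z<y) , fill-above v w wh wj (≤-reflexive v≡))
    where
    v = inject₁ vj
    v≡ = Fin.toℕ-inject₁ vj
  d : i < j → j < toℕ fh → toℕ fh < k → Lt w i k → ¬ Lt w k j
  d i<j j<h h<k (_ , _ , ai , ak , x<z) (_ , _ , ak′ , aj , z<y) with At-functional ak ak′
  ... | refl with At-value⇒lookup ai | At-value⇒lookup aj | At-value⇒lookup ak
  ... | fi , vi , refl , refl , wi | fj , vj , refl , refl , wj | fk , vk , refl , refl , wk =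
    refute v (fi , fj , fh , fk , i<j , j<h , h<k ,
      fill-mono v w wi wk x<z , fill-mono v w wk wj z<y , fill-below v w wj wh ≤-refl)
    where
    -- The hole plays the 4 and goes just above the 3, the largest of the other letters.
    v = Fin.suc vj

-- Of the occurrence, drop the last letter among `i₂`, `i₃`, `i₄` at or before the hole, or `i₁` if
-- there is none. The other three letters miss the hole and form one of the forbidden patterns.
Good⇒Avoids : ∀ {h} {w : Word m (suc m)} → (∀ {i} → At w i nothing → i ≡ h) → Good w h → Avoids1342 w
Good⇒Avoids {h = h} {w = w} unique g σ (_ , ext) (i₁ , i₂ , i₃ , i₄ , i₁<i₂ , i₂<i₃ , i₃<i₄ , σ₁<σ₄ , σ₄<σ₂ , σ₂<σ₃) = cases
  where
  lt : ∀ f g → toℕ f ≢ h → toℕ g ≢ h → lookup σ f Fin.< lookup σ g → Lt w (toℕ f) (toℕ g)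
  lt f g f≢h g≢h σ< with lookup w f in wf | lookup w g in wg | lookup⇒At w f | lookup⇒At w g
  ... | nothing | _       | af | _  = contradiction (unique af) f≢h
  ... | just a  | nothing | _  | ag = contradiction (unique ag) g≢h
  ... | just a  | just b  | af | ag = toℕ a , toℕ b , af , ag , from (ext f g a b wf wg) σ<
  σ₁<σ₂ = <-trans σ₁<σ₄ σ₄<σ₂
  σ₄<σ₃ = <-trans σ₄<σ₂ σ₂<σ₃
  cases : ⊥
  cases with toℕ i₂ ≤? h
  ... | no i₂≰h =
    let h<i₂ = ≰⇒> i₂≰h ; h<i₃ = <-trans h<i₂ i₂<i₃ ; h<i₄ = <-trans h<i₃ i₃<i₄ in
    no231 g h<i₂ i₂<i₃ i₃<i₄ (lt i₄ i₂ (>⇒≢ h<i₄) (>⇒≢ h<i₂) σ₄<σ₂) (lt i₂ i₃ (>⇒≢ h<i₂) (>⇒≢ h<i₃) σ₂<σ₃)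
  ... | yes i₂≤h with toℕ i₃ ≤? h
  ...   | no i₃≰h =
    let i₁<h = <-≤-trans i₁<i₂ i₂≤h ; h<i₃ = ≰⇒> i₃≰h ; h<i₄ = <-trans h<i₃ i₃<i₄ in
    no1∣32 g i₁<h h<i₃ i₃<i₄ (lt i₁ i₄ (<⇒≢ i₁<h) (>⇒≢ h<i₄) σ₁<σ₄) (lt i₄ i₃ (>⇒≢ h<i₄) (>⇒≢ h<i₃) σ₄<σ₃)
  ...   | yes i₃≤h with toℕ i₄ ≤? h
  ...     | no i₄≰h =
    let i₂<h = <-≤-trans i₂<i₃ i₃≤h ; i₁<h = <-trans i₁<i₂ i₂<h ; h<i₄ = ≰⇒> i₄≰h in
    no13∣2 g i₁<i₂ i₂<h h<i₄ (lt i₁ i₄ (<⇒≢ i₁<h) (>⇒≢ h<i₄) σ₁<σ₄) (lt i₄ i₂ (>⇒≢ h<i₄) (<⇒≢ i₂<h) σ₄<σ₂)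
  ...     | yes i₄≤h =
    let i₃<h = <-≤-trans i₃<i₄ i₄≤h ; i₂<h = <-trans i₂<i₃ i₃<h ; i₁<h = <-trans i₁<i₂ i₂<h in
    no123 g i₁<i₂ i₂<i₃ i₃<h (lt i₁ i₂ (<⇒≢ i₁<h) (<⇒≢ i₂<h) σ₁<σ₂) (lt i₂ i₃ (<⇒≢ i₂<h) (<⇒≢ i₃<h) σ₂<σ₃)

-- Enumeration by the tree.

LabelledWord : ℕ → Set
LabelledWord m = Word m (suc m) × Label

child : Word m (suc m) → ℕ × Label → LabelledWord (suc m)
child w (p , t) = addMax p w , t

children : LabelledWord m → List (LabelledWord (suc m))
children {m} (w , t) = map (child w) (moves m t)

tree : ∀ m → List (LabelledWord m)
tree zero    = (nothing ∷ [] , front (0 ∷ [])) ∷ []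
tree (suc m) = concatMap children (tree m)

Labelled : LabelledWord m → Set
Labelled (w , t) = IsPartialPerm1 w × Labels t w

Labels-root : Labels (front (0 ∷ [])) (nothing ∷ [])
Labels-root = record
  { atHole     = here refl
  ; uniqueHole = λ { (here _) → refl ; (there ()) }
  ; good       = record
    { no123  = λ { _ _ _ (_ , _ , here () , _) _ }
    ; no231  = λ { _ _ _ (_ , _ , here () , _) _ }
    ; no1∣32 = λ { _ _ _ (_ , _ , here () , _) _ }
    ; no13∣2 = λ { _ _ _ (_ , _ , here () , _) _ } }
  ; left       = λ q → mk⇔ (λ { z≤n → z≤n , Valid-zero }) proj₁
  ; right      = λ q → mk⇔ (λ { (here refl) → Valid-end z<s }) (λ v → here (n≤0⇒n≡0 (s≤s⁻¹ (bound v))))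
  ; descending = [] ∷ []
  }

tree-sound : ∀ m → All Labelled (tree m)
tree-sound zero    = ((refl , λ ()) , Labels-root) ∷ []
tree-sound (suc m) = All.concat⁺ (All.map⁺ (All.map (λ { {w , t} (pp , l) →
  All.map⁺ (All.map (λ { {p , _} (_ , l′) → IsPartialPerm1-addMax⁺ p pp , l′ }) (moves-sound l)) }) (tree-sound m)))

-- Removing the maximum leaves a good word, in the tree by induction, and the site used is valid,
-- hence among its moves. Goodness is assumed wherever the hole is, since its position is read off a
-- label found only by the recursive call.
tree-complete : ∀ m (w : Word m (suc m)) → IsPartialPerm1 w → (∀ {h} → At w h nothing → Good w h) →
                ∃ λ t → (w , t) ∈ tree m
tree-complete zero    (nothing ∷ []) pp g = _ , here refl
tree-complete (suc m) w pp g with removeMax w (proj₂ pp (fromℕ m))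
... | p , v , p≤n , refl
  with tree-complete m v (IsPartialPerm1-addMax⁻ p pp) (λ a → Good-addMax⁻ p (g (At-skip⁺ p a)))
... | t , vt∈
  with All.lookup (tree-sound m) vt∈
... | _ , l
  with moves-complete l (Good-addMax⇒Valid p≤n (g (At-skip⁺ p (atHole l))))
... | t′ , pt′∈ =
  t′ , ∈-concatMap⁺ children (Any.map (λ { refl → ∈-map⁺ (child v) pt′∈ }) vt∈)

DistinctWords : LabelledWord m → LabelledWord m → Set
DistinctWords a b = proj₁ a ≢ proj₁ b

-- Siblings differ in the site and cousins in the word left after removal of the maximum;
-- `addMax-injective` recovers both.
children-distinct : (xs : List (LabelledWord m)) → All Labelled xs → AllPairs DistinctWords xs →
                    AllPairs DistinctWords (concatMap children xs)
children-distinct []             []            []             = []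
children-distinct {m} ((w , t) ∷ xs) ((_ , l) ∷ ls) (w∉ ∷ distinct) =
  AllPairs.++⁺ (AllPairs.map⁺ (siblings (moves-sound l) (moves-distinct l))) (children-distinct xs ls distinct)
    (All.map⁺ (All.map (λ b → All.concat⁺ (All.map⁺ (cousins b ls w∉))) (moves-sound l)))
  where
  siblings : ∀ {ms} → All (Sound w) ms → AllPairs Distinct ms → AllPairs (λ a b → DistinctWords (child w a) (child w b)) ms
  siblings []       []       = []
  siblings (b ∷ bs) (d ∷ ds) =
    All.zipWith (λ { (b′ , p≢q) eq → p≢q (proj₁ (addMax-injective (proj₁ b) (proj₁ b′) eq)) }) (bs , d) ∷ siblings bs ds
  cousins : ∀ {a ys} → Sound w a → All Labelled ys → All (DistinctWords (w , t)) ys →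
            All (λ y → All (DistinctWords (child w a)) (children y)) ys
  cousins b []              []       = []
  cousins b ((_ , l′) ∷ ls) (d ∷ ds) =
    All.map⁺ (All.map (λ b′ eq → d (proj₂ (addMax-injective (proj₁ b) (proj₁ b′) eq))) (moves-sound l′))
    ∷ cousins b ls ds

tree-distinct : ∀ m → AllPairs DistinctWords (tree m)
tree-distinct zero    = [] ∷ []
tree-distinct (suc m) = children-distinct (tree m) (tree-sound m) (tree-distinct m)

-- By `moves-total`, going one level down the tree lowers by one the depth at which descendants are
-- counted. At n = 0 every word counts once.
tree-total : ∀ m n → Σℤ (total n ∘ proj₂) (tree m) ≡ total (m + n) (front (0 ∷ []))
tree-total zero    n = ℤ.+-identityʳ (total n (front (0 ∷ [])))
tree-total (suc m) n = begin
  Σℤ (total n ∘ proj₂) (tree (suc m))            ≡⟨ Σℤ-concatMap (total n ∘ proj₂) children (tree m) ⟩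
  Σℤ (Σℤ (total n ∘ proj₂) ∘ children) (tree m)  ≡⟨ Σℤ-cong one (tree m) ⟩
  Σℤ (total (suc n) ∘ proj₂) (tree m)            ≡⟨ tree-total m (suc n) ⟩
  total (m + suc n) (front (0 ∷ []))             ≡⟨ cong (λ N → total N (front (0 ∷ []))) (+-suc m n) ⟩
  total (suc m + n) (front (0 ∷ []))             ∎
  where
  open ≡-Reasoning
  one : (x : LabelledWord m) → Σℤ (total n ∘ proj₂) (children x) ≡ total (suc n) (proj₂ x)
  one (w , t) = trans (Σℤ-map (total n ∘ proj₂) (child w) (moves m t)) (moves-total m n t)

tree-length : ∀ m → + length (tree m) ≡ total m (front (0 ∷ []))
tree-length m = begin
  + length (tree m)                   ≡⟨ ℤ.*-identityʳ (+ length (tree m)) ⟨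
  + length (tree m) ℤ.* ℤ.1ℤ          ≡⟨ Σℤ-const ℤ.1ℤ (tree m) ⟨
  Σℤ (λ _ → ℤ.1ℤ) (tree m)            ≡⟨ Σℤ-cong (λ x → sym (total-zero (proj₂ x))) (tree m) ⟩
  Σℤ (total 0 ∘ proj₂) (tree m)       ≡⟨ tree-total m 0 ⟩
  total (m + 0) (front (0 ∷ []))      ≡⟨ cong (λ N → total N (front (0 ∷ []))) (+-identityʳ m) ⟩
  total m (front (0 ∷ []))            ∎
  where open ≡-Reasoning

theorem31 : (m : ℕ) →
    HasCard (λ π → IsPartialPerm1 {m} π × Avoids1342 π)
    ((2 * m) C m ∸ binomℤ (2 * m) (+ m - + 4))
theorem31 m =
  map proj₁ (tree m) ,
  AllPairs.map⁺ (tree-distinct m) ,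
  (λ π → mk⇔ sound complete) ,
  trans (List.length-map proj₁ (tree m)) (count-formula (length (tree m)) m (tree-length m))
  where
  sound : ∀ {π} → π ∈ map proj₁ (tree m) → IsPartialPerm1 π × Avoids1342 π
  sound π∈ with ∈-map⁻ proj₁ π∈
  ... | (w , t) , wt∈ , refl with All.lookup (tree-sound m) wt∈
  ...   | pp , l = pp , Good⇒Avoids (uniqueHole l) (good l)
  complete : ∀ {π} → IsPartialPerm1 π × Avoids1342 π → π ∈ map proj₁ (tree m)
  complete {π} (pp , av) with tree-complete m π pp (Avoids⇒Good pp av)
  ... | t , πt∈ = ∈-map⁺ proj₁ πt∈
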